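{- Let $G=(V,E)$ be a finite simple undirected graph, $\tau$ a threshold assignment of $G$, and $k\ge1$ an integer. Consider the integer linear program in binary variables $x_{vi},y_{vi}\in\{0,1\}$ ($v\in V$, $0\le i\le k$): minimize $\sum_{i=0}^k\sum_{v\in V}x_{vi}$ subject to 1. $(d(v)+1-\tau(v))\,y_{vi}+\tau(v)-1\ \ge\ \sum_{u\in N(v)}(x_{u(i-1)}+y_{u(i-1)})$ for all $v\in V$, $1\le i\le k$; 2. $\sum_{u\in N(v)}(x_{u(i-1)}+y_{u(i-1)})-\tau(v)\,y_{vi}\ \ge\ 0$ for all $v\in V$, $1\le i\le k$; 3. $x_{vk}+y_{vk}=1$ for all $v\in V$; 4. $x_{vi}+y_{vi}\le1$ for all $v\in V$, $0\le i\le k$; 5. $y_{v0}=0$ for all $v\in V$. This program formulates the problem of finding the minimum size of a timed target set which reaches the fully positive configuration in $k$ steps: its optimal value equals the minimum of $\sum_{i=0}^k|\mathcal{S}_i|$ over all sequences $\mathcal{S}_0,\ldots,\mathcal{S}_k$ of subsets of $V$ for which $\mathcal{A}_k=V$, where $\mathcal{A}_i=\mathcal{S}_i\cup Q_i$ is the set of positive nodes in step $i$.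
   Context: $N(v)$ is the set of neighbors of $v$ and $d(v)=|N(v)|$. A threshold assignment is a function $\tau:V\to\mathbb{N}\cup\{0\}$ with $0\le\tau(v)\le d(v)$ for all $v$. Given a sequence $\mathcal{S}_0,\ldots,\mathcal{S}_k$ of subsets of $V$ ($\mathcal{S}_i$ being the nodes the manipulator chooses to be positive in step $i$), the sets $Q_0,\ldots,Q_k$ are defined by $Q_0=\emptyset$ and, for $i\ge1$, $Q_i=\{v\in V: |N(v)\cap(\mathcal{S}_{i-1}\cup Q_{i-1})|\ge\tau(v)\}$. A sequence $\mathcal{S}_0,\ldots,\mathcal{S}_m$ is a timed target set (TTS) if $\mathcal{S}_m=\emptyset$ and $Q_m=V$; its size is $\sum_{i=0}^m|\mathcal{S}_i|$. (If $\mathcal{A}_k=V$, then appending $\mathcal{S}_{k+1}=\emptyset$ gives a TTS of the same size, since $\tau(v)\le d(v)$.) -}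

module Defs where

open import Level using (0ℓ)
open import Algebra.Properties.CommutativeMonoid.Sum using (sum)
open import Data.Bool.Base using (if_then_else_)
open import Data.Fin.Base using (Fin; zero; suc; inject₁; fromℕ)
open import Data.Fin.Subset using (Subset; ⊥; ⊤; _∩_; _∪_; ∣_∣)
open import Data.Integer as ℤ using (ℤ; 0ℤ; 1ℤ)
import Data.Integer.Properties as ℤ
open import Data.Nat.Base as ℕ using (ℕ)
import Data.Nat.Properties as ℕ
open import Data.Product using (_×_; ∃-syntax)
open import Data.Sum.Base using (_⊎_)
open import Data.Vec.Base using (tabulate; lookup)
open import Function.Base using (_∘_)
open import Relation.Binary.Core using (Rel)
open import Relation.Binary.Definitions using (Decidable; Symmetric; Irreflexive)
open import Relation.Binary.PropositionalEquality using (_≡_; refl; cong)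
open import Relation.Nullary.Decidable using (does)

record SimpleGraph (n : ℕ) : Set₁ where
  field
    Adj       : Rel (Fin n) 0ℓ
    adj?      : Decidable Adj
    symmetric : Symmetric Adj
    loopless  : Irreflexive _≡_ Adj

  N : Fin n → Subset n
  N v = tabulate (λ u → does (adj? v u))

  d : Fin n → ℕ
  d v = ∣ N v ∣

∑ℕ : ∀ {n} → (Fin n → ℕ) → ℕ
∑ℕ = sum ℕ.+-0-commutativeMonoid

∑ℤ : ∀ {n} → (Fin n → ℤ) → ℤ
∑ℤ = sum ℤ.+-0-commutativeMonoid

∑ℤ∈ : ∀ {n} → Subset n → (Fin n → ℤ) → ℤ
∑ℤ∈ p f = ∑ℤ (λ u → if lookup p u then f u else 0ℤ)

IsMinimum : ∀ {a p b ℓ} {A : Set a} {B : Set b} →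
            Rel B ℓ → (A → Set p) → (A → B) → B → Set _
IsMinimum _≤_ P f m = (∃[ a ] P a × f a ≡ m) × (∀ a → P a → m ≤ f a)

module _ {n : ℕ} (G : SimpleGraph n) where
  open SimpleGraph G

  IsThresholdAssignment : (Fin n → ℕ) → Set
  IsThresholdAssignment τ = ∀ v → τ v ℕ.≤ d v

  module _ (τ : Fin n → ℕ) where

    activated : Subset n → Subset n
    activated P = tabulate (λ v → does (τ v ℕ.≤? ∣ N v ∩ P ∣))

    -- Qᵢ only depends on S₀, …, Sᵢ₋₁, so the recursion drops the last set of
    -- the sequence; Q-suc below is the recurrence for the sequence itself.
    Q : ∀ {k} → (Fin (ℕ.suc k) → Subset n) → Fin (ℕ.suc k) → Subset n
    Q         S zero    = ⊥
    Q {ℕ.suc k} S (suc i) = activated (S (inject₁ i) ∪ Q (S ∘ inject₁) i)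

    positive : ∀ {k} → (Fin (ℕ.suc k) → Subset n) → Fin (ℕ.suc k) → Subset n
    positive S i = S i ∪ Q S i

    Q-inject₁ : ∀ {k} (S : Fin (ℕ.suc (ℕ.suc k)) → Subset n) (i : Fin (ℕ.suc k)) →
                Q (S ∘ inject₁) i ≡ Q S (inject₁ i)
    Q-inject₁           S zero    = refl
    Q-inject₁ {ℕ.suc k} S (suc i) =
      cong (λ P → activated (S (inject₁ (inject₁ i)) ∪ P)) (Q-inject₁ (S ∘ inject₁) i)

    Q-suc : ∀ {k} (S : Fin (ℕ.suc k) → Subset n) (i : Fin k) →
            Q S (suc i) ≡ activated (positive S (inject₁ i))
    Q-suc {ℕ.suc k} S i = cong (λ P → activated (S (inject₁ i) ∪ P)) (Q-inject₁ S i)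

    ReachesAll : ∀ {k} → (Fin (ℕ.suc k) → Subset n) → Set
    ReachesAll {k} S = positive S (fromℕ k) ≡ ⊤

    -- The step i with 1 ≤ i ≤ k is encoded as suc i for i : Fin k, and its
    -- predecessor as inject₁ i.
    record Feasible {k : ℕ} (x y : Fin n → Fin (ℕ.suc k) → ℤ) : Set where
      field
        x-binary    : ∀ v i → x v i ≡ 0ℤ ⊎ x v i ≡ 1ℤ
        y-binary    : ∀ v i → y v i ≡ 0ℤ ⊎ y v i ≡ 1ℤ
        constraint₁ : ∀ v (i : Fin k) →
          ((ℤ.+ d v) ℤ.+ 1ℤ ℤ.- (ℤ.+ τ v)) ℤ.* y v (suc i) ℤ.+ (ℤ.+ τ v) ℤ.- 1ℤ
            ℤ.≥ ∑ℤ∈ (N v) (λ u → x u (inject₁ i) ℤ.+ y u (inject₁ i))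
        constraint₂ : ∀ v (i : Fin k) →
          ∑ℤ∈ (N v) (λ u → x u (inject₁ i) ℤ.+ y u (inject₁ i))
            ℤ.- (ℤ.+ τ v) ℤ.* y v (suc i) ℤ.≥ 0ℤ
        constraint₃ : ∀ v → x v (fromℕ k) ℤ.+ y v (fromℕ k) ≡ 1ℤ
        constraint₄ : ∀ v i → x v i ℤ.+ y v i ℤ.≤ 1ℤ
        constraint₅ : ∀ v → y v zero ≡ 0ℤ

size : ∀ {n k} → (Fin (ℕ.suc k) → Subset n) → ℕ
size S = ∑ℕ (λ i → ∣ S i ∣)

objective : ∀ {n k} → (Fin n → Fin (ℕ.suc k) → ℤ) → ℤ
objective x = ∑ℤ (λ i → ∑ℤ (λ v → x v i))

{-# OPTIONS --safe #-}
-- For a sequence S, the indicator functions of Sᵢ ∖ Qᵢ and of Qᵢ form a feasible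
-- point of objective at most size S (removing Qᵢ from Sᵢ keeps Sᵢ ∪ Qᵢ and makes
-- constraint 4 hold).  Conversely, as 0 ≤ |N(v) ∩ P| ≤ d(v), constraints 1 and 2
-- say exactly that a binary y_{vi} indicates whether v reaches its threshold; so
-- in a feasible point y is, by induction on i, the indicator of Q for the sequence
-- indicated by x, and the objective is the size of that sequence.
module Submission where

open import Defs
open import Algebra.Properties.CommutativeMonoid.Sum using (sum-cong-≗)
open import Data.Bool.Base using (Bool; true; false; if_then_else_; _∧_; _∨_)
import Data.Bool.Properties as Bool
open import Data.Fin.Base using (Fin; zero; suc; inject₁; fromℕ)
open import Data.Fin.Induction using (<-weakInduction)
open import Data.Fin.Subset using (Subset; ⊤; _∩_; _∪_; _─_; ∣_∣; inside; outside)
open import Data.Fin.Subset.Properties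
  using (anySubset?; ∪-zeroˡ; p─q⊆p; p⊆q⇒∣p∣≤∣q∣; ∣p∩q∣≤∣p∣)
open import Data.Integer.Base as ℤ using (ℤ; 0ℤ; 1ℤ; +≤+)
import Data.Integer.Properties as ℤ
open import Data.Integer.Tactic.RingSolver using (solve-∀)
open import Data.Nat.Base as ℕ using (ℕ; suc; z≤n; s≤s)
open import Data.Nat.Induction using (<-wellFounded)
import Data.Nat.Properties as ℕ
open import Data.Product using (_×_; _,_; ∃; ∃-syntax; proj₁; proj₂)
open import Data.Sum.Base using (_⊎_; inj₁; inj₂)
open import Data.Vec.Base using ([]; _∷_; lookup; tabulate)
import Data.Vec.Functional as Vector
open import Data.Vec.Properties
  using (lookup∘tabulate; lookup-zipWith; lookup-replicate; tabulate∘lookup; tabulate-cong; ≡-dec)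
open import Function.Base using (_∘_; const)
open import Induction.WellFounded using (Acc; acc)
open import Relation.Binary.PropositionalEquality
open import Relation.Nullary using (contradiction)
open import Relation.Nullary.Decidable using (Dec; yes; no; does; map′; _×-dec_)
open import Relation.Unary using (Pred; Decidable)

-- Minima: existence by search, and transfer between two problems.

module _ {a p} {A : Set a} {P : A → Set p} {f : A → ℕ} where

  -- Well-founded descent on the value: each query either yields a strictly smaller witness or
  -- certifies that the current one is least.
  IsMinimum-exists : (∀ m → Dec (∃[ a ] P a × f a ℕ.< m)) → ∃ P → ∃[ m ] IsMinimum ℕ._≤_ P f m
  IsMinimum-exists smaller? (a , Pa) = descend a Pa (<-wellFounded (f a))
    where
    descend : ∀ a → P a → Acc ℕ._<_ (f a) → ∃[ m ] IsMinimum ℕ._≤_ P f m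
    descend a Pa (acc rec) with smaller? (f a)
    ... | yes (b , Pb , fb<fa) = descend b Pb (rec fb<fa)
    ... | no  ∄smaller         = f a , (a , Pa , refl) , λ b Pb → ℕ.≮⇒≥ λ fb<fa → ∄smaller (b , Pb , fb<fa)

  -- No bijection is asked for, only a partner of no larger value in each direction. This fits the
  -- problem, since trimming a sequence can strictly decrease its size.
  IsMinimum-transfer : ∀ {b q} {B : Set b} {Q : B → Set q} {g : B → ℤ} →
    (∀ a → P a → ∃[ b ] Q b × g b ℤ.≤ ℤ.+ f a) →
    (∀ b → Q b → ∃[ a ] P a × ℤ.+ f a ℤ.≤ g b) →
    ∀ {m} → IsMinimum ℕ._≤_ P f m → IsMinimum ℤ._≤_ Q g (ℤ.+ m)
  IsMinimum-transfer {B = B} {Q = Q} {g = g} to from {m} ((a , Pa , refl) , least) =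
    (b , Qb , ℤ.≤-antisym gb≤fa (lower b Qb)) , lower
    where
    lower : ∀ b → Q b → ℤ.+ m ℤ.≤ g b
    lower b Qb = let a , Pa , fa≤gb = from b Qb in ℤ.≤-trans (+≤+ (least a Pa)) fa≤gb
    b : B
    b = proj₁ (to a Pa)
    Qb : Q b
    Qb = proj₁ (proj₂ (to a Pa))
    gb≤fa : g b ℤ.≤ ℤ.+ f a
    gb≤fa = proj₂ (proj₂ (to a Pa))

-- Induction on the length, searching over the first set. `P` must respect `≗` because a function is
-- only pointwise equal to the one rebuilt from its head and tail.
anySequence? : ∀ {n ℓ} k {P : Pred (Fin k → Subset n) ℓ} →
  (∀ {S T} → S ≗ T → P S → P T) → Decidable P → Dec (∃ P)
anySequence? ℕ.zero  resp P? = map′ (λ PS → _ , PS) (λ (_ , PS) → resp (λ ()) PS) (P? λ ())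
anySequence? (suc k) resp P? =
  map′ (λ (p , S , PS) → p Vector.∷ S , PS)
       (λ (S , PS) → S zero , S ∘ suc , resp (λ { zero → refl ; (suc i) → refl }) PS)
       (anySubset? λ p → anySequence? k
         (λ S≗T → resp λ { zero → refl ; (suc i) → S≗T i })
         (λ S → P? (p Vector.∷ S)))

-- Indicator functions and their sums.

χ : Bool → ℤ
χ b = if b then 1ℤ else 0ℤ

χ≡1⇒true : ∀ {b} → χ b ≡ 1ℤ → b ≡ true
χ≡1⇒true {true} refl = refl

χ-binary : ∀ b → χ b ≡ 0ℤ ⊎ χ b ≡ 1ℤ
χ-binary false = inj₁ refl
χ-binary true  = inj₂ refl

χ≤1 : ∀ b → χ b ℤ.≤ 1ℤ
χ≤1 false = +≤+ z≤n
χ≤1 true  = ℤ.≤-refl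

binary⇒χ : ∀ {z} → z ≡ 0ℤ ⊎ z ≡ 1ℤ → z ≡ χ (does (z ℤ.≟ 1ℤ))
binary⇒χ (inj₁ refl) = refl
binary⇒χ (inj₂ refl) = refl

-- The bound excludes the one bad case, `1 + 1`.
χ-∨ : ∀ a b → χ a ℤ.+ χ b ℤ.≤ 1ℤ → χ a ℤ.+ χ b ≡ χ (a ∨ b)
χ-∨ false false _ = refl
χ-∨ false true  _ = refl
χ-∨ true  false _ = refl
χ-∨ true  true  (+≤+ (s≤s ()))

χ∈ : ∀ {n} → Subset n → Fin n → ℤ
χ∈ p v = χ (lookup p v)

χ∈-∪ : ∀ {n} (p q : Subset n) v → χ∈ p v ℤ.+ χ∈ q v ℤ.≤ 1ℤ → χ∈ p v ℤ.+ χ∈ q v ≡ χ∈ (p ∪ q) v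
χ∈-∪ p q v ≤1 = trans (χ-∨ (lookup p v) (lookup q v) ≤1) (cong χ (sym (lookup-zipWith _∨_ v p q)))

-- The sets `p ─ q` and `q` are disjoint, so their indicators add up without overlap.
χ∈-─ : ∀ {n} (p q : Subset n) v → χ∈ (p ─ q) v ℤ.+ χ∈ q v ≡ χ∈ (p ∪ q) v
χ∈-─ (outside ∷ p) (outside ∷ q) zero    = refl
χ∈-─ (inside  ∷ p) (outside ∷ q) zero    = refl
χ∈-─ (outside ∷ p) (inside  ∷ q) zero    = refl
χ∈-─ (inside  ∷ p) (inside  ∷ q) zero    = refl
χ∈-─ (_       ∷ p) (outside ∷ q) (suc v) = χ∈-─ p q v
χ∈-─ (_       ∷ p) (inside  ∷ q) (suc v) = χ∈-─ p q v

∑ℤ-cong : ∀ {n} {f g : Fin n → ℤ} → f ≗ g → ∑ℤ f ≡ ∑ℤ g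
∑ℤ-cong = sum-cong-≗ ℤ.+-0-commutativeMonoid

∑ℤ-χ∈ : ∀ {n} (p : Subset n) → ∑ℤ (χ∈ p) ≡ ℤ.+ ∣ p ∣
∑ℤ-χ∈ []            = refl
∑ℤ-χ∈ (outside ∷ p) = trans (ℤ.+-identityˡ _) (∑ℤ-χ∈ p)
∑ℤ-χ∈ (inside  ∷ p) = cong ℤ.suc (∑ℤ-χ∈ p)

-- Turns the neighbour sums of constraints 1 and 2 into the counts in the threshold rule.
∑ℤ∈-χ∈ : ∀ {n} (p q : Subset n) {f : Fin n → ℤ} → f ≗ χ∈ q → ∑ℤ∈ p f ≡ ℤ.+ ∣ p ∩ q ∣
∑ℤ∈-χ∈ p q {f} f≗χ = trans (∑ℤ-cong restrict) (∑ℤ-χ∈ (p ∩ q))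
  where
  restrict : ∀ u → (if lookup p u then f u else 0ℤ) ≡ χ∈ (p ∩ q) u
  restrict u rewrite lookup-zipWith _∧_ u p q with lookup p u
  ... | true  = f≗χ u
  ... | false = refl

∑ℤ-+ : ∀ {k} (f : Fin k → ℕ) → ∑ℤ (λ i → ℤ.+ f i) ≡ ℤ.+ ∑ℕ f
∑ℤ-+ {ℕ.zero} f = refl
∑ℤ-+ {suc k}  f = cong (λ z → ℤ.+ f zero ℤ.+ z) (∑ℤ-+ (f ∘ suc))

objective-χ∈ : ∀ {n k} {x : Fin n → Fin (suc k) → ℤ} (S : Fin (suc k) → Subset n) →
  (∀ v i → x v i ≡ χ∈ (S i) v) → objective x ≡ ℤ.+ size S
objective-χ∈ S x≡χ =
  trans (∑ℤ-cong λ i → trans (∑ℤ-cong λ v → x≡χ v i) (∑ℤ-χ∈ (S i))) (∑ℤ-+ (∣_∣ ∘ S))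

∑ℕ-mono-≤ : ∀ {k} {f g : Fin k → ℕ} → (∀ i → f i ℕ.≤ g i) → ∑ℕ f ℕ.≤ ∑ℕ g
∑ℕ-mono-≤ {ℕ.zero} f≤g = z≤n
∑ℕ-mono-≤ {suc k}  f≤g = ℕ.+-mono-≤ (f≤g zero) (∑ℕ-mono-≤ (f≤g ∘ suc))

lookup≡true⇒≡⊤ : ∀ {n} (p : Subset n) → (∀ v → lookup p v ≡ true) → p ≡ ⊤
lookup≡true⇒≡⊤ p h = begin
  p                    ≡⟨ tabulate∘lookup p ⟨
  tabulate (lookup p)  ≡⟨ tabulate-cong (λ v → trans (h v) (sym (lookup-replicate v inside))) ⟩
  tabulate (lookup ⊤)  ≡⟨ tabulate∘lookup ⊤ ⟩
  ⊤                    ∎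
  where open ≡-Reasoning

-- Constraints 1 and 2 at a single vertex and step, with neighbour sum `s`.

ThresholdBounds : (d τ : ℕ) (y s : ℤ) → Set
ThresholdBounds d τ y s =
  ((ℤ.+ d ℤ.+ 1ℤ ℤ.- ℤ.+ τ) ℤ.* y ℤ.+ ℤ.+ τ ℤ.- 1ℤ ℤ.≥ s) × (s ℤ.- ℤ.+ τ ℤ.* y ℤ.≥ 0ℤ)

-- The coefficient of `y` is chosen so that the upper bound on `s` is the degree for `y = 1` and
-- `τ - 1` for `y = 0`.
upper-1 : ∀ d t → (d ℤ.+ 1ℤ ℤ.- t) ℤ.* 1ℤ ℤ.+ t ℤ.- 1ℤ ≡ d
upper-1 = solve-∀

-- The right-hand side is the unfolding of `ℤ.pred t`, so that `s ≤ τ - 1` can be exchanged with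
-- `s < τ`.
upper-0 : ∀ d t → (d ℤ.+ 1ℤ ℤ.- t) ℤ.* 0ℤ ℤ.+ t ℤ.- 1ℤ ≡ ℤ.-1ℤ ℤ.+ t
upper-0 = solve-∀

lower-0 : ∀ s t → s ℤ.- t ℤ.* 0ℤ ≡ s
lower-0 = solve-∀

bounds-intro : ∀ {d τ s} (t? : Dec (τ ℕ.≤ s)) → s ℕ.≤ d → ThresholdBounds d τ (χ (does t?)) (ℤ.+ s)
bounds-intro {d} {τ} {s} (yes τ≤s) s≤d
  rewrite upper-1 (ℤ.+ d) (ℤ.+ τ) | ℤ.*-identityʳ (ℤ.+ τ)
  = +≤+ s≤d , ℤ.i≤j⇒0≤j-i (+≤+ τ≤s)
bounds-intro {d} {τ} {s} (no τ≰s) s≤d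
  rewrite upper-0 (ℤ.+ d) (ℤ.+ τ) | lower-0 (ℤ.+ s) (ℤ.+ τ)
  = ℤ.i<j⇒i≤pred[j] (ℤ.+<+ (ℕ.≰⇒> τ≰s)) , +≤+ z≤n

-- A wrong value of `y` violates one bound: `y = 0` forces `s < τ` by the upper one, `y = 1` forces
-- `τ ≤ s` by the lower one.
bounds-elim : ∀ {d τ s y} (t? : Dec (τ ℕ.≤ s)) → y ≡ 0ℤ ⊎ y ≡ 1ℤ →
  ThresholdBounds d τ y (ℤ.+ s) → y ≡ χ (does t?)
bounds-elim (yes _) (inj₂ refl) _ = refl
bounds-elim (no _)  (inj₁ refl) _ = refl
bounds-elim {d} {τ} {s} (yes τ≤s) (inj₁ refl) (upper , _)
  rewrite upper-0 (ℤ.+ d) (ℤ.+ τ)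
  = contradiction τ≤s (ℕ.<⇒≱ (ℤ.drop‿+<+ (ℤ.i≤pred[j]⇒i<j {j = ℤ.+ τ} upper)))
bounds-elim {d} {τ} {s} (no τ≰s) (inj₂ refl) (_ , lower)
  rewrite ℤ.*-identityʳ (ℤ.+ τ)
  = contradiction (ℤ.drop‿+≤+ (ℤ.0≤i-j⇒j≤i lower)) τ≰s

-- Activation along a sequence, and a sequence of minimum size.

module _ {n : ℕ} (G : SimpleGraph n) (τ : Fin n → ℕ) where
  open SimpleGraph G

  reaches? : (v : Fin n) (P : Subset n) → Dec (τ v ℕ.≤ ∣ N v ∩ P ∣)
  reaches? v P = τ v ℕ.≤? ∣ N v ∩ P ∣

  Q-cong : ∀ {k} {S T : Fin (suc k) → Subset n} → S ≗ T → Q G τ S ≗ Q G τ T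
  Q-cong         S≗T zero    = refl
  Q-cong {suc k} S≗T (suc i) =
    cong (activated G τ) (cong₂ _∪_ (S≗T (inject₁ i)) (Q-cong (S≗T ∘ inject₁) i))

  ReachesAll-resp : ∀ {k} {S T : Fin (suc k) → Subset n} → S ≗ T → ReachesAll G τ S → ReachesAll G τ T
  ReachesAll-resp {k} S≗T = trans (sym (cong₂ _∪_ (S≗T (fromℕ k)) (Q-cong S≗T (fromℕ k))))

  size-cong : ∀ {k} {S T : Fin (suc k) → Subset n} → S ≗ T → size S ≡ size T
  size-cong S≗T = sum-cong-≗ ℕ.+-0-commutativeMonoid (cong ∣_∣ ∘ S≗T)

  minimumSize : ∀ k → ∃[ m ] IsMinimum ℕ._≤_ (ReachesAll G τ {k}) size m
  -- Choosing every vertex at every step succeeds, which starts the descent.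
  minimumSize k = IsMinimum-exists smaller? (const ⊤ , ∪-zeroˡ (Q G τ (const ⊤) (fromℕ k)))
    where
    smaller? : ∀ m → Dec (∃[ S ] ReachesAll G τ {k} S × size S ℕ.< m)
    smaller? m = anySequence? (suc k)
      (λ S≗T (r , l) → ReachesAll-resp S≗T r , subst (ℕ._< m) (size-cong S≗T) l)
      (λ S → ≡-dec Bool._≟_ (positive G τ S (fromℕ k)) ⊤ ×-dec (size S ℕ.<? m))

  χ∈-Q-suc : ∀ {k} (S : Fin (suc k) → Subset n) (i : Fin k) v →
    χ∈ (Q G τ S (suc i)) v ≡ χ (does (reaches? v (positive G τ S (inject₁ i))))
  χ∈-Q-suc S i v = trans (cong (λ P → χ∈ P v) (Q-suc G τ S i)) (cong χ (lookup∘tabulate _ v))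

  -- From a sequence to a feasible point.

  module _ {k : ℕ} (S : Fin (suc k) → Subset n) (all : ReachesAll G τ S) where

    private
      x y : Fin n → Fin (suc k) → ℤ
      -- `Q` is that of the untrimmed `S`: the linear constraints see `x` only through `x + y`,
      -- which indicates the original positive set.
      x v i = χ∈ (S i ─ Q G τ S i) v
      y v i = χ∈ (Q G τ S i) v

      x+y : ∀ v i → x v i ℤ.+ y v i ≡ χ∈ (positive G τ S i) v
      x+y v i = χ∈-─ (S i) (Q G τ S i) v

      bounds : ∀ v (i : Fin k) →
        ThresholdBounds (d v) (τ v) (y v (suc i)) (∑ℤ∈ (N v) λ u → x u (inject₁ i) ℤ.+ y u (inject₁ i))
      bounds v i = subst₂ (ThresholdBounds (d v) (τ v))
        (sym (χ∈-Q-suc S i v))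
        (sym (∑ℤ∈-χ∈ (N v) P (λ u → x+y u (inject₁ i))))
        (bounds-intro (reaches? v P) (∣p∩q∣≤∣p∣ (N v) P))
        where
        P : Subset n
        P = positive G τ S (inject₁ i)

      feasible : Feasible G τ x y
      feasible = record
        { x-binary    = λ v i → χ-binary _
        ; y-binary    = λ v i → χ-binary _
        ; constraint₁ = λ v i → proj₁ (bounds v i)
        ; constraint₂ = λ v i → proj₂ (bounds v i)
        ; constraint₃ = λ v → trans (x+y v (fromℕ k))
            (trans (cong (λ P → χ∈ P v) all) (cong χ (lookup-replicate v inside)))
        ; constraint₄ = λ v i → subst (ℤ._≤ 1ℤ) (sym (x+y v i)) (χ≤1 _)
        ; constraint₅ = λ v → cong χ (lookup-replicate v outside)
        }

    ReachesAll⇒Feasible : ∃[ (x , y) ] Feasible G τ {k} x y × objective x ℤ.≤ ℤ.+ size S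
    ReachesAll⇒Feasible = (x , y) , feasible ,
      subst (ℤ._≤ ℤ.+ size S) (sym (objective-χ∈ (λ i → S i ─ Q G τ S i) λ v i → refl))
        (+≤+ (∑ℕ-mono-≤ λ i → p⊆q⇒∣p∣≤∣q∣ (p─q⊆p (S i) (Q G τ S i))))

  -- From a feasible point to a sequence.

  module _ {k : ℕ} {x y : Fin n → Fin (suc k) → ℤ} (feasible : Feasible G τ x y) where
    open Feasible feasible

    private
      S : Fin (suc k) → Subset n
      S i = tabulate λ v → does (x v i ℤ.≟ 1ℤ)

      x≡χ : ∀ v i → x v i ≡ χ∈ (S i) v
      x≡χ v i = trans (binary⇒χ (x-binary v i)) (cong χ (sym (lookup∘tabulate _ v)))

      -- Constraint 4 keeps the two sets disjoint. The premise concerns the single step `i`, so that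
      -- the induction for `y≡χ` can supply it.
      x+y : ∀ {i} → (∀ v → y v i ≡ χ∈ (Q G τ S i) v) → ∀ v → x v i ℤ.+ y v i ≡ χ∈ (positive G τ S i) v
      x+y {i} y≡χ v = trans eq (χ∈-∪ (S i) (Q G τ S i) v (subst (ℤ._≤ 1ℤ) eq (constraint₄ v i)))
        where
        eq : x v i ℤ.+ y v i ≡ χ∈ (S i) v ℤ.+ χ∈ (Q G τ S i) v
        eq = cong₂ ℤ._+_ (x≡χ v i) (y≡χ v)

      y≡χ : ∀ i v → y v i ≡ χ∈ (Q G τ S i) v
      y≡χ = <-weakInduction _
        (λ v → trans (constraint₅ v) (cong χ (sym (lookup-replicate v outside))))
        -- `ih` is about `inject₁ i`, the step whose neighbour sums bound `y` at `suc i`.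
        (λ i ih v → let P = positive G τ S (inject₁ i) in
          trans (bounds-elim (reaches? v P) (y-binary v (suc i))
                  (subst (ThresholdBounds (d v) (τ v) (y v (suc i))) (∑ℤ∈-χ∈ (N v) P (x+y ih))
                    (constraint₁ v i , constraint₂ v i)))
                (sym (χ∈-Q-suc S i v)))

    Feasible⇒ReachesAll : ∃[ S ] ReachesAll G τ {k} S × ℤ.+ size S ℤ.≤ objective x
    Feasible⇒ReachesAll = S ,
      -- Constraint 3 says that the indicator of the last positive set is 1 everywhere.
      lookup≡true⇒≡⊤ _ (λ v → χ≡1⇒true (trans (sym (x+y (y≡χ (fromℕ k)) v)) (constraint₃ v))) ,
      ℤ.≤-reflexive (sym (objective-χ∈ S x≡χ))

mainTheorem5 : ∀ {n : ℕ} (G : SimpleGraph n) (τ : Fin n → ℕ) → IsThresholdAssignment G τ →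
    (k : ℕ) → 1 ℕ.≤ k →
    ∃[ m ]
    IsMinimum {A = (Fin n → Fin (suc k) → ℤ) × (Fin n → Fin (suc k) → ℤ)} ℤ._≤_
    (λ (x , y) → Feasible G τ x y) (λ (x , y) → objective x) (ℤ.+ m)
    × IsMinimum {A = Fin (suc k) → Subset n} ℕ._≤_ (ReachesAll G τ) size m
mainTheorem5 G τ _ k _ =
  let m , minimal = minimumSize G τ k in
  m , IsMinimum-transfer (ReachesAll⇒Feasible G τ) (λ _ → Feasible⇒ReachesAll G τ) minimal , minimal
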